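{- For all $n\geq 1$, \[\bar{a}_2(n)=2\bar{p}(n)-\bar{p}(n+1)+\bar{u}(n+1),\] where $\bar{u}(N)$ is the number of overpartitions of $N$ such that: (1) $1$ is not a part; (2) the smallest part is overlined and no other part has the same value; (3) the values of the largest and second largest parts are either equal, or consecutive with the second largest part overlined.
   Context: An overpartition of $n$ is a partition of $n$ in which the first occurrence of each distinct part value may be overlined. $\bar{p}(n)$ is the number of overpartitions of $n$. $\bar{a}_m(n)$ is the number of overpartitions of $n$ in which the smallest part value occurs at least $m$ times, where an overlined part and a non-overlined part of the same value are counted as equal (e.g. $\bar{1}+1$ has smallest part $1$ occurring twice). -}

module Defs where

open import Data.Bool using (Bool; true; false)
import Data.Bool.Properties as Bool
open import Data.Empty using (⊥)
open import Data.List
  using (List; []; _∷_; length; map; filter; upTo; cartesianProduct; cartesianProductWith)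
import Data.List.Membership.DecPropositional as DecMembership
open import Data.List.Membership.Propositional using (_∈_; _∉_)
open import Data.List.Membership.Propositional.Properties
  using (∈-upTo⁺; ∈-cartesianProduct⁺; ∈-cartesianProductWith⁺; ∈-cartesianProductWith⁻;
         ∈-filter⁺; ∈-filter⁻)
open import Data.List.Properties using (∷-injective)
open import Data.List.Relation.Unary.All as All using (All; []; _∷_; all?)
open import Data.List.Relation.Unary.Any using (Any; here; there; any?)
open import Data.List.Relation.Unary.AllPairs using ([]; _∷_)
open import Data.List.Relation.Unary.Linked using (Linked; linked?)
open import Data.List.Relation.Unary.Unique.Propositional using (Unique)
import Data.List.Relation.Unary.Unique.Propositional.Properties as Unique
open import Data.Nat using (ℕ; zero; suc; _+_; _≤_; _>_; z≤n; s≤s; _≟_; _≤?_; _>?_)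
open import Data.Nat.ListAction using (sum)
open import Data.Nat.Properties using (≤-refl; ≤-trans; +-mono-≤; m≤m+n; m≤n+m)
open import Data.Product using (_×_; _,_; proj₁; proj₂)
import Data.Product.Properties as Product
open import Data.Sum using (_⊎_)
open import Function using (_⇔_; mk⇔)
open import Relation.Binary.Definitions using (DecidableEquality)
open import Relation.Binary.PropositionalEquality using (_≡_; refl)
open import Relation.Nullary using (Dec; no)
open import Relation.Nullary.Decidable using (_×-dec_; _⊎-dec_)
open import Relation.Unary using (Pred; Decidable)
open import Level using (0ℓ)

-- The symbol v is (v , false) and the overlined symbol v̄ is (v , true).
Part : Set
Part = ℕ × Bool

value : Part → ℕ
value = proj₁

overlined : Part → Bool
overlined = proj₂

_≟ᵖ_ : DecidableEquality Part
_≟ᵖ_ = Product.≡-dec _≟_ Bool._≟_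

-- p may be followed immediately by q.  In a list with weakly decreasing
-- values, a part is the first occurrence of its value exactly when it does
-- not have the same value as the part just before it; only then may it be
-- overlined.
_≽_ : Part → Part → Set
p ≽ q = value p > value q ⊎ (value p ≡ value q × overlined q ≡ false)

_≽?_ : ∀ p q → Dec (p ≽ q)
p ≽? q = (value p >? value q) ⊎-dec ((value p ≟ value q) ×-dec (overlined q Bool.≟ false))

IsOverpartition : ℕ → List Part → Set
IsOverpartition n ps =
  Linked _≽_ ps × All (λ p → 1 ≤ value p) ps × sum (map value ps) ≡ n

isOverpartition? : ∀ n → Decidable (IsOverpartition n)
isOverpartition? n ps =
  linked? _≽?_ ps ×-dec (all? (λ p → 1 ≤? value p) ps ×-dec (sum (map value ps) ≟ n))

-- All lists of length at most k with entries in as.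
words : ∀ {A : Set} → List A → ℕ → List (List A)
words as zero    = [] ∷ []
words as (suc k) = [] ∷ cartesianProductWith _∷_ as (words as k)

symbols : ℕ → List Part
symbols n = cartesianProduct (upTo (suc n)) (false ∷ true ∷ [])

-- An overpartition of n has at most n parts, each of value at most n.
-- That every overpartition of n is listed exactly once is the content of
-- ∈-overpartitions and overpartitions-unique below.
overpartitions : ℕ → List (List Part)
overpartitions n = filter (isOverpartition? n) (words (symbols n) n)

count : ∀ {P : Pred (List Part) 0ℓ} → Decidable P → ℕ → ℕ
count P? n = length (filter P? (overpartitions n))

private
  value-bound : ∀ ps → All (λ p → value p ≤ sum (map value ps)) ps
  value-bound []       = []
  value-bound (p ∷ ps) =
    m≤m+n (value p) _ ∷ All.map (λ le → ≤-trans le (m≤n+m _ (value p))) (value-bound ps)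

  length-bound : ∀ {ps} → All (λ p → 1 ≤ value p) ps → length ps ≤ sum (map value ps)
  length-bound []         = z≤n
  length-bound (le ∷ les) = +-mono-≤ le (length-bound les)

  ∈-symbols : ∀ {n} p → value p ≤ n → p ∈ symbols n
  ∈-symbols (v , false) le = ∈-cartesianProduct⁺ (∈-upTo⁺ (s≤s le)) (here refl)
  ∈-symbols (v , true)  le = ∈-cartesianProduct⁺ (∈-upTo⁺ (s≤s le)) (there (here refl))

  ∈-words : ∀ {A : Set} {as : List A} {k xs} → All (_∈ as) xs → length xs ≤ k → xs ∈ words as k
  ∈-words {k = zero}  []         z≤n      = here refl
  ∈-words {k = suc k} []         z≤n      = here refl
  ∈-words {k = suc k} (x∈ ∷ xs∈) (s≤s le) =
    there (∈-cartesianProductWith⁺ _∷_ x∈ (∈-words xs∈ le))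

  words-unique : ∀ {A : Set} {as : List A} → Unique as → ∀ k → Unique (words as k)
  words-unique           u zero    = [] ∷ []
  words-unique {as = as} u (suc k) =
    All.tabulate nonempty ∷ Unique.cartesianProductWith⁺ _∷_ ∷-injective u (words-unique u k)
    where
    nonempty : ∀ {xs} → xs ∈ cartesianProductWith _∷_ as (words as k) → [] ≡ xs → ⊥
    nonempty xs∈ refl with ∈-cartesianProductWith⁻ _∷_ as (words as k) xs∈
    ... | _ , _ , _ , _ , ()

∈-overpartitions : ∀ n ps → ps ∈ overpartitions n ⇔ IsOverpartition n ps
∈-overpartitions n ps = mk⇔
  (λ ps∈ → proj₂ (∈-filter⁻ (isOverpartition? n) {xs = words (symbols n) n} ps∈))
  complete
  where
  complete : IsOverpartition n ps → ps ∈ overpartitions n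
  complete h@(_ , pos , refl) = ∈-filter⁺ (isOverpartition? n)
    (∈-words (All.map (∈-symbols _) (value-bound ps)) (length-bound pos)) h

overpartitions-unique : ∀ n → Unique (overpartitions n)
overpartitions-unique n = Unique.filter⁺ (isOverpartition? n)
  (words-unique (Unique.cartesianProduct⁺ (Unique.upTo⁺ (suc n)) (((λ ()) ∷ []) ∷ [] ∷ [])) n)

multiplicity : ℕ → List Part → ℕ
multiplicity v ps = length (filter (λ p → value p ≟ v) ps)

IsSmallestValue : List Part → ℕ → Set
IsSmallestValue ps v = All (λ p → v ≤ value p) ps

isSmallestValue? : ∀ ps v → Dec (IsSmallestValue ps v)
isSmallestValue? ps v = all? (λ p → v ≤? value p) ps

SmallestOccurs≥ : ℕ → List Part → Set
SmallestOccurs≥ m ps =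
  Any (λ p → IsSmallestValue ps (value p) × m ≤ multiplicity (value p) ps) ps

smallestOccurs≥? : ∀ m → Decidable (SmallestOccurs≥ m)
smallestOccurs≥? m ps =
  any? (λ p → isSmallestValue? ps (value p) ×-dec (m ≤? multiplicity (value p) ps)) ps

-- Parts are symbols here: 1 and 1̄ are different parts of the same value, so
-- this condition excludes the non-overlined 1 and allows 1̄.
1NotAPart : List Part → Set
1NotAPart ps = (1 , false) ∉ ps

1NotAPart? : Decidable 1NotAPart
1NotAPart? ps = DecMembership._∉?_ _≟ᵖ_ (1 , false) ps

SmallestOverlinedAlone : List Part → Set
SmallestOverlinedAlone ps =
  Any (λ p → IsSmallestValue ps (value p) × overlined p ≡ true × multiplicity (value p) ps ≡ 1) ps

smallestOverlinedAlone? : Decidable SmallestOverlinedAlone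
smallestOverlinedAlone? ps =
  any? (λ p → isSmallestValue? ps (value p) ×-dec
              ((overlined p Bool.≟ true) ×-dec (multiplicity (value p) ps ≟ 1))) ps

-- In an overpartition the first two entries are the largest and the second
-- largest part, counted with repetition.  With fewer than two parts there is
-- no second largest part and the condition fails.
TopTwoClose : List Part → Set
TopTwoClose (p ∷ q ∷ _) =
  value p ≡ value q ⊎ (value p ≡ suc (value q) × overlined q ≡ true)
TopTwoClose _           = ⊥

topTwoClose? : Decidable TopTwoClose
topTwoClose? []          = no λ ()
topTwoClose? (_ ∷ [])    = no λ ()
topTwoClose? (p ∷ q ∷ _) =
  (value p ≟ value q) ⊎-dec ((value p ≟ suc (value q)) ×-dec (overlined q Bool.≟ true))

pbar : ℕ → ℕ
pbar n = length (overpartitions n)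

abar : ℕ → ℕ → ℕ
abar m = count (smallestOccurs≥? m)

ubar : ℕ → ℕ
ubar = count (λ ps → 1NotAPart? ps ×-dec (smallestOverlinedAlone? ps ×-dec topTwoClose? ps))

{-# OPTIONS --safe #-}

-- Put N = n + 1 and sort the overpartitions of N by their last (smallest) part.
-- Removing a final plain 1 leaves an arbitrary overpartition of n.  If the last part
-- is plain and at least 2, lowering it by one gives exactly the overpartitions
-- of n whose smallest part is plain and occurs once.  If it is overlined, and
-- the two largest parts are not close in the sense of ū, lowering the largest
-- part by one gives exactly the overpartitions of n whose smallest part is
-- overlined and occurs once; the close ones are counted by ū(N).  Hence
-- p̄(N) = p̄(n) + (p̄(n) − ā₂(n)) + ū(N).

module Submission where

open import Defs
open import Data.Nat using (ℕ; _≥_) renaming (_+_ to _+ℕ_)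
open import Data.Integer using (+_; _+_; _-_; _*_)
open import Relation.Binary.PropositionalEquality using (_≡_)

open import Data.Bool using (true; false)
open import Data.Bool.Properties using (¬-not)
open import Data.Integer using (ℤ)
import Data.Integer.Tactic.RingSolver as ℤ-Solver
open import Data.List
  using (List; []; _∷_; _++_; _∷ʳ_; [_]; length; map; filter; reverse; initLast; _∷ʳ′_)
open import Data.List.Membership.Propositional using (_∈_; find; lose)
open import Data.List.Membership.Propositional.Properties
  using (∈-filter⁺; ∈-filter⁻; ∈-map⁺; ∈-map⁻; ∈-++⁻; ∈-++⁺ʳ)
open import Data.List.Membership.Propositional.Properties.WithK using (unique∧set⇒bag)
open import Data.List.Properties
  using (∷-injective; ∷ʳ-injectiveˡ; reverse-injective; reverse-++; reverse-involutive;
         unfold-reverse; map-++; length-++; length-map;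
         filter-++; filter-accept; filter-all; filter-none; filter-some; filter-≐)
open import Data.List.Relation.Binary.BagAndSetEquality using (∼bag⇒↭)
open import Data.List.Relation.Binary.Permutation.Propositional.Properties using (↭-length)
open import Data.List.Relation.Unary.All as All using (All; []; _∷_)
import Data.List.Relation.Unary.All.Properties as All
open import Data.List.Relation.Unary.AllPairs using (AllPairs; []; _∷_)
import Data.List.Relation.Unary.AllPairs.Properties as AllPairs
open import Data.List.Relation.Unary.Any using (here)
import Data.List.Relation.Unary.Any.Properties as Any
open import Data.List.Relation.Unary.Linked using (Linked; []; [-]; _∷_)
open import Data.List.Relation.Unary.Linked.Properties using (Linked⇒AllPairs; AllPairs⇒Linked)
import Data.List.Relation.Unary.Unique.Propositional.Properties as Unique
open import Data.Nat using (zero; suc; _≤_; _>_; _≟_; s≤s; z≤n)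
open import Data.Nat.ListAction using (sum)
open import Data.Nat.ListAction.Properties using (sum-++)
open import Data.Nat.Properties
  using (+-comm; +-suc; +-assoc; +-identityʳ; suc-injective; ≤-refl; ≤-reflexive; ≤-trans;
         <⇒≤; <-irrefl; <-≤-trans; ≤-antisym; m≤n⇒m<n∨m≡n; n≮n)
open import Data.Product using (∃; _×_; _,_; proj₁; proj₂)
open import Data.Sum using (inj₁; inj₂)
open import Data.Unit using (tt)
open import Function using (_∘_; Equivalence; mk⇔; Injective)
open import Level using (0ℓ)
open import Relation.Binary.Core using (Rel)
open import Relation.Binary.PropositionalEquality
  using (refl; sym; trans; cong; cong₂; subst; module ≡-Reasoning)
open import Relation.Nullary using (¬_; yes; no; contradiction)
open import Relation.Nullary.Decidable using (decidable-stable)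
open import Relation.Unary using (Pred; Decidable; U; ∁; _∩_)
open import Relation.Unary.Properties using (U?; ∁?; _∩?_)

private
  variable
    A : Set
    P Q : Pred A 0ℓ
    n : ℕ
    q : Part
    ps : List Part

-- Splitting counts and counting by bijection

AllPairs-∷ʳ⁻ : ∀ {R : Rel A 0ℓ} xs {x} → AllPairs R (xs ∷ʳ x) → AllPairs R xs × All (λ y → R y x) xs
AllPairs-∷ʳ⁻ []       _         = [] , []
AllPairs-∷ʳ⁻ (y ∷ xs) (ry ∷ rs) =
  let ryxs , ryx = All.∷ʳ⁻ ry
      rxs , rx   = AllPairs-∷ʳ⁻ xs rs
  in ryxs ∷ rxs , ryx ∷ rx

length-filter-split : (P? : Decidable P) (Q? : Decidable Q) (xs : List A) →
  length (filter P? xs) ≡ length (filter (P? ∩? Q?) xs) +ℕ length (filter (P? ∩? ∁? Q?) xs)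
length-filter-split P? Q? []       = refl
length-filter-split P? Q? (x ∷ xs) with ih ← length-filter-split P? Q? xs | P? x | Q? x
... | no  _ | _     = ih
... | yes _ | yes _ = cong suc ih
... | yes _ | no  _ = trans (cong suc ih) (sym (+-suc _ _))

count-split : (P? : Decidable P) (Q? : Decidable Q) → ∀ n →
  count P? n ≡ count (P? ∩? Q?) n +ℕ count (P? ∩? ∁? Q?) n
count-split P? Q? n = length-filter-split P? Q? (overpartitions n)

count-cong : (P? : Decidable P) (Q? : Decidable Q) →
  (∀ {ps} → P ps → Q ps) → (∀ {ps} → Q ps → P ps) → ∀ n → count P? n ≡ count Q? n
count-cong P? Q? to from n = cong length (filter-≐ P? Q? (to , from) (overpartitions n))

pbar≡count-U : ∀ n → pbar n ≡ count U? n
pbar≡count-U n = cong length (sym (filter-all U? (All.universal (λ _ → tt) (overpartitions n))))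

pbar-split : (P? : Decidable P) → ∀ n → pbar n ≡ count P? n +ℕ count (∁? P?) n
pbar-split P? n = begin
  pbar n                                           ≡⟨ pbar≡count-U n ⟩
  count U? n                                       ≡⟨ count-split U? P? n ⟩
  count (U? ∩? P?) n +ℕ count (U? ∩? ∁? P?) n      ≡⟨ cong₂ _+ℕ_
    (count-cong (U? ∩? P?) P? proj₂ (tt ,_) n)
    (count-cong (U? ∩? ∁? P?) (∁? P?) proj₂ (tt ,_) n) ⟩
  count P? n +ℕ count (∁? P?) n                    ∎
  where open ≡-Reasoning

-- Injectivity of `f` and uniqueness of the enumerations make both `map f xs` and `ys` free of
-- duplicates. `into` and `onto` give them the same members, so they are permutations of each other
-- and have equal length. Since `onto` supplies a preimage for each list, no inverse function has to
-- be defined.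
count-bijection : (P? : Decidable P) (Q? : Decidable Q) → ∀ m n (f : List Part → List Part) →
  Injective _≡_ _≡_ f →
  (∀ ps → IsOverpartition m ps → P ps → IsOverpartition n (f ps) × Q (f ps)) →
  (∀ qs → IsOverpartition n qs → Q qs → ∃ λ ps → (IsOverpartition m ps × P ps) × qs ≡ f ps) →
  count P? m ≡ count Q? n
count-bijection P? Q? m n f inj into onto = trans (sym (length-map f xs))
  (↭-length (∼bag⇒↭ (unique∧set⇒bag
    (Unique.map⁺ inj (Unique.filter⁺ P? (overpartitions-unique m)))
    (Unique.filter⁺ Q? (overpartitions-unique n))
    (mk⇔ to from))))
  where
  xs = filter P? (overpartitions m)
  ys = filter Q? (overpartitions n)

  to : ∀ {qs} → qs ∈ map f xs → qs ∈ ys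
  to qs∈ with ps , ps∈ , refl ← ∈-map⁻ f qs∈ =
    let ps∈m , Pps  = ∈-filter⁻ P? {xs = overpartitions m} ps∈
        isn , Qps = into ps (Equivalence.to (∈-overpartitions m ps) ps∈m) Pps
    in ∈-filter⁺ Q? (Equivalence.from (∈-overpartitions n (f ps)) isn) Qps

  from : ∀ {qs} → qs ∈ ys → qs ∈ map f xs
  from {qs} qs∈ =
    let qs∈n , Qqs = ∈-filter⁻ Q? {xs = overpartitions n} qs∈
        ps , (ism , Pps) , eq = onto qs (Equivalence.to (∈-overpartitions n qs) qs∈n) Qqs
    in subst (_∈ map f xs) (sym eq)
         (∈-map⁺ f (∈-filter⁺ P? (Equivalence.from (∈-overpartitions m ps) ism) Pps))

-- The order between parts

≽⇒≥ : ∀ p q → p ≽ q → value q ≤ value p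
≽⇒≥ _ _ (inj₁ p>q)      = <⇒≤ p>q
≽⇒≥ _ _ (inj₂ (eq , _)) = ≤-reflexive (sym eq)

≽-overlined⇒> : ∀ p q → p ≽ q → overlined q ≡ true → value p > value q
≽-overlined⇒> _ _ (inj₁ p>q)         _  = p>q
≽-overlined⇒> _ _ (inj₂ (_ , plain)) ov with () ← trans (sym plain) ov

≥-plain⇒≽ : ∀ p v → v ≤ value p → p ≽ (v , false)
≥-plain⇒≽ _ _ v≤p with m≤n⇒m<n∨m≡n v≤p
... | inj₁ v<p = inj₁ v<p
... | inj₂ v≡p = inj₂ (sym v≡p , refl)

-- Transitivity turns the condition on neighbours into one on all pairs, so that every earlier part
-- can be compared directly with the last one.
≽-trans : ∀ p q r → p ≽ q → q ≽ r → p ≽ r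
≽-trans p q _ p≽q               (inj₁ q>r)        = inj₁ (<-≤-trans q>r (≽⇒≥ p q p≽q))
≽-trans _ _ _ (inj₁ p>q)        (inj₂ (refl , _)) = inj₁ p>q
≽-trans _ _ _ (inj₂ (refl , _)) (inj₂ q≡r)        = inj₂ q≡r

Linked≽⇒AllPairs≽ : Linked _≽_ ps → AllPairs _≽_ ps
Linked≽⇒AllPairs≽ = Linked⇒AllPairs λ {p} {q} {r} → ≽-trans p q r

1≽⇒≡1 : ∀ p → (1 , false) ≽ p → 1 ≤ value p → p ≡ (1 , false)
1≽⇒≡1 _ (inj₁ (s≤s p≤0)) 1≤p with () ← ≤-trans 1≤p p≤0
1≽⇒≡1 _ (inj₂ (refl , refl)) _ = refl

-- Overpartitions seen from their last part

EndsIn : ℕ → List Part → Part → Set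
EndsIn n xs p = AllPairs _≽_ xs × All (_≽ p) xs × 1 ≤ value p × sum (map value xs) +ℕ value p ≡ n

sum-∷ʳ : ∀ xs p → sum (map value (xs ∷ʳ p)) ≡ sum (map value xs) +ℕ value p
sum-∷ʳ xs p = begin
  sum (map value (xs ∷ʳ p))                 ≡⟨ cong sum (map-++ value xs [ p ]) ⟩
  sum (map value xs ∷ʳ value p)             ≡⟨ sum-++ (map value xs) [ value p ] ⟩
  sum (map value xs) +ℕ (value p +ℕ 0)      ≡⟨ cong (sum (map value xs) +ℕ_) (+-identityʳ (value p)) ⟩
  sum (map value xs) +ℕ value p             ∎
  where open ≡-Reasoning

∷ʳ⁺ : ∀ xs p → EndsIn n xs p → IsOverpartition n (xs ∷ʳ p)
∷ʳ⁺ xs p (xs≽ , xs≽p , 1≤p , eq) =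
  AllPairs⇒Linked (AllPairs.++⁺ xs≽ ([] ∷ []) (All.map (_∷ []) xs≽p)) ,
  -- All earlier parts are at least `p`, so positivity of `p` gives positivity of the whole list.
  All.∷ʳ⁺ (All.map (λ {q} → ≤-trans 1≤p ∘ ≽⇒≥ q p) xs≽p) 1≤p ,
  trans (sum-∷ʳ xs p) eq

∷ʳ⁻ : ∀ xs p → IsOverpartition n (xs ∷ʳ p) → EndsIn n xs p
∷ʳ⁻ xs p (linked , pos , eq) =
  let xs≽ , xs≽p = AllPairs-∷ʳ⁻ xs (Linked≽⇒AllPairs≽ linked)
  in xs≽ , xs≽p , proj₂ (All.∷ʳ⁻ pos) , trans (sym (sum-∷ʳ xs p)) eq

multiplicity-∷ʳ : ∀ xs p → multiplicity (value p) (xs ∷ʳ p) ≡ suc (multiplicity (value p) xs)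
multiplicity-∷ʳ xs p = begin
  length (filter V? (xs ∷ʳ p))
    ≡⟨ cong length (filter-++ V? xs [ p ]) ⟩
  length (filter V? xs ++ filter V? [ p ])
    ≡⟨ length-++ (filter V? xs) ⟩
  multiplicity (value p) xs +ℕ length (filter V? [ p ])
    ≡⟨ cong (λ zs → multiplicity (value p) xs +ℕ length zs) (filter-accept V? refl) ⟩
  multiplicity (value p) xs +ℕ 1
    ≡⟨ +-comm _ 1 ⟩
  suc (multiplicity (value p) xs)
    ∎
  where
  open ≡-Reasoning
  V? = λ q → value q ≟ value p

multiplicity-last : ∀ xs p → All (λ q → value q > value p) xs → multiplicity (value p) (xs ∷ʳ p) ≡ 1
multiplicity-last xs p xs>p = trans (multiplicity-∷ʳ xs p)
  (cong (suc ∘ length) (filter-none (λ q → value q ≟ value p)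
    (All.map (λ q>p eq → <-irrefl (sym eq) q>p) xs>p)))

multiplicity-repeated : ∀ xs p → q ∈ xs → value q ≡ value p → 2 ≤ multiplicity (value p) (xs ∷ʳ p)
multiplicity-repeated xs p q∈xs eq = subst (2 ≤_) (sym (multiplicity-∷ʳ xs p))
  (s≤s (filter-some (λ r → value r ≟ value p) (lose q∈xs eq)))

last-smallest : ∀ xs p → All (_≽ p) xs → IsSmallestValue (xs ∷ʳ p) (value p)
last-smallest xs p xs≽p = All.∷ʳ⁺ (All.map (λ {q} → ≽⇒≥ q p) xs≽p) ≤-refl

overlined⇒> : ∀ {xs} p → All (_≽ p) xs → overlined p ≡ true → All (λ q → value q > value p) xs
overlined⇒> p xs≽p ov = All.map (λ {q} q≽p → ≽-overlined⇒> q p q≽p ov) xs≽p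

-- Only a first occurrence can be overlined, so every earlier part has a strictly larger value than
-- an overlined last part.
overlined⇒alone : ∀ xs p → All (_≽ p) xs → overlined p ≡ true → SmallestOverlinedAlone (xs ∷ʳ p)
overlined⇒alone xs p xs≽p ov = Any.++⁺ʳ xs
  (here (last-smallest xs p xs≽p , ov , multiplicity-last xs p (overlined⇒> p xs≽p ov)))

-- The witness may sit anywhere in the list. If it lay in `xs`, minimality together with `≽ p` would
-- give it the value of `p`, and that value would then occur at least twice.
alone⇒overlined : ∀ xs p → All (_≽ p) xs → SmallestOverlinedAlone (xs ∷ʳ p) → overlined p ≡ true
alone⇒overlined xs p xs≽p alone with Any.++⁻ xs alone
... | inj₂ (here (_ , ov , _)) = ov
... | inj₁ any with q , q∈xs , (small , _ , once) ← find any
  with q≡p ← ≤-antisym (proj₂ (All.∷ʳ⁻ small)) (≽⇒≥ q p (All.lookup xs≽p q∈xs))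
  with s≤s () ← subst (2 ≤_) (trans (cong (λ v → multiplicity v (xs ∷ʳ p)) (sym q≡p)) once)
                  (multiplicity-repeated xs p q∈xs q≡p)

-- The last part has multiplicity one by strictness, and an earlier witness would need a value at
-- most that of `p`.
>⇒¬repeated : ∀ xs p → All (λ q → value q > value p) xs → ¬ SmallestOccurs≥ 2 (xs ∷ʳ p)
>⇒¬repeated xs p xs>p rep with Any.++⁻ xs rep
... | inj₂ (here (_ , twice)) with s≤s () ← subst (2 ≤_) (multiplicity-last xs p xs>p) twice
>⇒¬repeated xs p xs>p rep | inj₁ any with q , q∈xs , (small , _) ← find any
  = n≮n _ (<-≤-trans (All.lookup xs>p q∈xs) (proj₂ (All.∷ʳ⁻ small)))

-- A part that precedes `p` without being strictly larger ties with it in value, and such a tie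
-- makes the smallest value occur twice.
¬repeated⇒> : ∀ xs p → All (_≽ p) xs → ¬ SmallestOccurs≥ 2 (xs ∷ʳ p) → All (λ q → value q > value p) xs
¬repeated⇒> xs p xs≽p ¬rep = All.tabulate λ {q} q∈xs → strict q∈xs (All.lookup xs≽p q∈xs)
  where
  strict : ∀ {q} → q ∈ xs → q ≽ p → value q > value p
  strict q∈xs (inj₁ q>p)       = q>p
  strict q∈xs (inj₂ (q≡p , _)) = contradiction
    (Any.++⁺ʳ xs (here (last-smallest xs p xs≽p , multiplicity-repeated xs p q∈xs q≡p))) ¬rep

-- The last part may follow every earlier part. After a plain 1 its value cannot drop further, being
-- positive, and a repeated 1 cannot be overlined.
1∈⇒last≡1 : ∀ xs p → EndsIn n xs p → (1 , false) ∈ xs ∷ʳ p → p ≡ (1 , false)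
1∈⇒last≡1 xs p (_ , xs≽p , 1≤p , _) 1∈ with ∈-++⁻ xs 1∈
... | inj₁ 1∈xs        = 1≽⇒≡1 p (All.lookup xs≽p 1∈xs) 1≤p
... | inj₂ (here refl) = refl

last≢1⇒1NotAPart : ∀ xs p → EndsIn n xs p → ¬ p ≡ (1 , false) → 1NotAPart (xs ∷ʳ p)
last≢1⇒1NotAPart xs p ends p≢1 = p≢1 ∘ 1∈⇒last≡1 xs p ends

-- Raising the first or the last part by one

sucPart : Part → Part
sucPart (v , b) = suc v , b

sucPart-injective : Injective _≡_ _≡_ sucPart
sucPart-injective refl = refl

sucHead : List Part → List Part
sucHead []       = []
sucHead (p ∷ ps) = sucPart p ∷ ps

sucHead-injective : Injective _≡_ _≡_ sucHead
sucHead-injective {[]}    {[]}    _  = refl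
sucHead-injective {p ∷ _} {q ∷ _} eq =
  let p≡q , ps≡qs = ∷-injective eq in cong₂ _∷_ (sucPart-injective p≡q) ps≡qs

-- Conjugating `sucHead` by `reverse` lets injectivity be inherited from the two; `sucLast-∷ʳ`
-- recovers the direct description.
sucLast : List Part → List Part
sucLast = reverse ∘ sucHead ∘ reverse

sucLast-injective : Injective _≡_ _≡_ sucLast
sucLast-injective = reverse-injective ∘ sucHead-injective ∘ reverse-injective

sucLast-∷ʳ : ∀ xs p → sucLast (xs ∷ʳ p) ≡ xs ∷ʳ sucPart p
sucLast-∷ʳ xs p = begin
  reverse (sucHead (reverse (xs ∷ʳ p)))   ≡⟨ cong (reverse ∘ sucHead) (reverse-++ xs [ p ]) ⟩
  reverse (sucPart p ∷ reverse xs)        ≡⟨ unfold-reverse (sucPart p) (reverse xs) ⟩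
  reverse (reverse xs) ∷ʳ sucPart p       ≡⟨ cong (_∷ʳ sucPart p) (reverse-involutive xs) ⟩
  xs ∷ʳ sucPart p                         ∎
  where open ≡-Reasoning

-- Overpartitions containing a plain 1

count-with-1 : ∀ n → count (∁? 1NotAPart?) (suc n) ≡ pbar n
count-with-1 n = sym (trans (pbar≡count-U n)
  (count-bijection U? (∁? 1NotAPart?) n (suc n) (_∷ʳ (1 , false)) (∷ʳ-injectiveˡ _ _) into onto))
  where
  into : ∀ ps → IsOverpartition n ps → U ps →
    IsOverpartition (suc n) (ps ∷ʳ (1 , false)) × ¬ 1NotAPart (ps ∷ʳ (1 , false))
  into ps (linked , pos , eq) _ =
    ∷ʳ⁺ ps _ (Linked≽⇒AllPairs≽ linked , All.map (λ {p} → ≥-plain⇒≽ p 1) pos , ≤-refl ,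
              trans (+-comm _ 1) (cong suc eq)) ,
    λ 1∉ → 1∉ (∈-++⁺ʳ ps (here refl))

  onto : ∀ qs → IsOverpartition (suc n) qs → ¬ 1NotAPart qs →
    ∃ λ ps → (IsOverpartition n ps × U ps) × qs ≡ ps ∷ʳ (1 , false)
  onto qs over ¬1∉ with initLast qs
  ... | []       = contradiction (λ ()) ¬1∉
  ... | xs ∷ʳ′ p with ends@(xs≽ , xs≽p , 1≤p , eq) ← ∷ʳ⁻ xs p over
    -- Membership of the plain 1 is only available doubly negated; decidable equality of parts turns
    -- it into an actual equation for the last part.
    with refl ← decidable-stable (p ≟ᵖ (1 , false)) (¬1∉ ∘ last≢1⇒1NotAPart xs p ends)
    = xs , (over⁻ , tt) , refl
    where
    over⁻ : IsOverpartition n xs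
    over⁻ = AllPairs⇒Linked xs≽ , All.map (λ {q} → ≽⇒≥ q p) xs≽p ,
            suc-injective (trans (+-comm 1 _) eq)

-- Plain smallest part of value at least 2

count-plain-last : ∀ n → 1 ≤ n →
  count (∁? (smallestOccurs≥? 2) ∩? ∁? smallestOverlinedAlone?) n ≡
  count (1NotAPart? ∩? ∁? smallestOverlinedAlone?) (suc n)
count-plain-last n 1≤n = count-bijection _ _ n (suc n) sucLast sucLast-injective into onto
  where
  into : ∀ ps → IsOverpartition n ps → (∁ (SmallestOccurs≥ 2) ∩ ∁ SmallestOverlinedAlone) ps →
    IsOverpartition (suc n) (sucLast ps) × (1NotAPart ∩ ∁ SmallestOverlinedAlone) (sucLast ps)
  into ps over (¬rep , ¬alone) with initLast ps
  -- The empty list satisfies both negated conditions, so it has to be ruled out by `1 ≤ n`.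
  ... | [] = contradiction (≤-trans 1≤n (≤-reflexive (sym (proj₂ (proj₂ over))))) λ ()
  ... | xs ∷ʳ′ p@(v , true) with _ , xs≽p , _ ← ∷ʳ⁻ xs p over =
    contradiction (overlined⇒alone xs p xs≽p refl) ¬alone
  ... | xs ∷ʳ′ p@(v , false) with xs≽ , xs≽p , 1≤p , eq ← ∷ʳ⁻ xs p over rewrite sucLast-∷ʳ xs p =
    ∷ʳ⁺ xs (suc v , false) ends ,
    last≢1⇒1NotAPart xs _ ends (λ where refl → contradiction 1≤p λ ()) ,
    λ alone → contradiction (alone⇒overlined xs _ xs≽p⁺ alone) λ ()
    where
    xs≽p⁺ : All (_≽ (suc v , false)) xs
    -- The earlier values exceed `v`, hence are at least `suc v`. A tie after raising is harmless
    -- because the raised part is plain.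
    xs≽p⁺ = All.map (λ {q} → ≥-plain⇒≽ q (suc v)) (¬repeated⇒> xs p xs≽p ¬rep)
    ends : EndsIn (suc n) xs (suc v , false)
    ends = xs≽ , xs≽p⁺ , s≤s z≤n , trans (+-suc _ v) (cong suc eq)

  onto : ∀ qs → IsOverpartition (suc n) qs → (1NotAPart ∩ ∁ SmallestOverlinedAlone) qs →
    ∃ λ ps → (IsOverpartition n ps × (∁ (SmallestOccurs≥ 2) ∩ ∁ SmallestOverlinedAlone) ps) ×
             qs ≡ sucLast ps
  onto qs over (1∉ , ¬alone) with initLast qs
  ... | [] with () ← proj₂ (proj₂ over)
  ... | xs ∷ʳ′ p with ∷ʳ⁻ xs p over
  onto _ over (1∉ , ¬alone) | xs ∷ʳ′ p@(v , true) | _ , xs≽p , _ =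
    contradiction (overlined⇒alone xs p xs≽p refl) ¬alone
  onto _ over (1∉ , ¬alone) | xs ∷ʳ′ (0 , false) | _ , _ , () , _
  onto _ over (1∉ , ¬alone) | xs ∷ʳ′ (1 , false) | _ = contradiction (∈-++⁺ʳ xs (here refl)) 1∉
  onto _ over (1∉ , ¬alone) | xs ∷ʳ′ (suc (suc v) , false) | xs≽ , xs≽p , _ , eq =
    xs ∷ʳ p⁻ ,
    (∷ʳ⁺ xs p⁻ (xs≽ , xs≽p⁻ , s≤s z≤n , suc-injective (trans (sym (+-suc _ _)) eq)) ,
     >⇒¬repeated xs p⁻ xs>p⁻ ,
     λ alone → contradiction (alone⇒overlined xs p⁻ xs≽p⁻ alone) λ ()) ,
    sym (sucLast-∷ʳ xs p⁻)
    where
    p⁻ : Part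
    p⁻ = suc v , false
    xs>p⁻ : All (λ q → value q > suc v) xs
    -- Lowering the last part breaks any tie with it, so its new value occurs once.
    xs>p⁻ = All.map (λ {q} → ≽⇒≥ q (suc (suc v) , false)) xs≽p
    xs≽p⁻ : All (_≽ p⁻) xs
    xs≽p⁻ = All.map inj₁ xs>p⁻

-- Overlined smallest part

alone⇒1NotAPart : ∀ ps → IsOverpartition n ps → SmallestOverlinedAlone ps → 1NotAPart ps
alone⇒1NotAPart ps over alone with initLast ps
... | xs ∷ʳ′ p with ends@(_ , xs≽p , _) ← ∷ʳ⁻ xs p over =
  last≢1⇒1NotAPart xs p ends λ where refl → contradiction (alone⇒overlined xs p xs≽p alone) λ ()

alone⇒¬repeated : ∀ ps → IsOverpartition n ps → SmallestOverlinedAlone ps → ¬ SmallestOccurs≥ 2 ps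
alone⇒¬repeated ps over alone with initLast ps
... | xs ∷ʳ′ p with _ , xs≽p , _ ← ∷ʳ⁻ xs p over =
  >⇒¬repeated xs p (overlined⇒> p xs≽p (alone⇒overlined xs p xs≽p alone))

-- The property amounts to the last part being overlined. That part either lies in `ps`, which is
-- common to both lists, or is the head itself, and the two heads carry the same mark.
alone-head : ∀ {m n p q} ps → overlined p ≡ overlined q →
  IsOverpartition m (p ∷ ps) → IsOverpartition n (q ∷ ps) →
  SmallestOverlinedAlone (p ∷ ps) → SmallestOverlinedAlone (q ∷ ps)
alone-head {p = p} {q} ps p≡q overp overq alone with initLast ps
... | [] = overlined⇒alone [] q [] (trans (sym p≡q) (alone⇒overlined [] p [] alone))
... | xs ∷ʳ′ r with _ , p≽r , _ ← ∷ʳ⁻ (p ∷ xs) r overp | _ , q≽r , _ ← ∷ʳ⁻ (q ∷ xs) r overq =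
  overlined⇒alone (q ∷ xs) r q≽r (alone⇒overlined (p ∷ xs) r p≽r alone)

sucHead-overpartition : ∀ p ps → IsOverpartition n (p ∷ ps) → IsOverpartition (suc n) (sucPart p ∷ ps)
sucHead-overpartition p ps (linked , _ ∷ pos , eq) = raise linked , s≤s z≤n ∷ pos , cong suc eq
  where
  raise : ∀ {ps} → Linked _≽_ (p ∷ ps) → Linked _≽_ (sucPart p ∷ ps)
  raise         [-]            = [-]
  -- The raised head is strictly above `q`, so the mark on `q` is allowed whatever it is.
  raise {q ∷ _} (p≽q ∷ linked) = inj₁ (s≤s (≽⇒≥ p q p≽q)) ∷ linked

-- Equal values after raising would put `p` below its successor. Consecutive values would mean a tie
-- before raising, which an overlined second part forbids.
sucHead-¬close : ∀ p ps → Linked _≽_ (p ∷ ps) → ¬ TopTwoClose (sucPart p ∷ ps)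
sucHead-¬close p (q ∷ _) (p≽q ∷ _) (inj₁ eq) = n≮n _ (≤-trans (≤-reflexive eq) (≽⇒≥ p q p≽q))
sucHead-¬close p (q ∷ _) (p≽q ∷ _) (inj₂ (eq , ov)) =
  <-irrefl (sym (suc-injective eq)) (≽-overlined⇒> p q p≽q ov)

-- The two ways of being close are exactly the two obstructions to lowering the head: it would fall
-- below the second part, or tie with an overlined one. The lowered head stays positive because it
-- is at least the second part, or, for a single part, because `1 ≤ n`.
predHead-overpartition : ∀ v b ps → 1 ≤ n → IsOverpartition (suc n) ((suc v , b) ∷ ps) →
  ¬ TopTwoClose ((suc v , b) ∷ ps) → IsOverpartition n ((v , b) ∷ ps)
predHead-overpartition v b [] 1≤n (_ , _ , eq) _ =
  [-] , subst (1 ≤_) (sym (trans (sym (+-identityʳ v)) (suc-injective eq))) 1≤n ∷ [] , suc-injective eq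
predHead-overpartition v b (q@(w , c) ∷ ps) _ (p≽q ∷ linked , _ ∷ pos@(1≤w ∷ _) , eq) ¬close =
  lower ∷ linked , ≤-trans 1≤w (≽⇒≥ (v , b) q lower) ∷ pos , suc-injective eq
  where
  w≤v : w ≤ v
  w≤v with m≤n⇒m<n∨m≡n (≽⇒≥ (suc v , b) q p≽q)
  ... | inj₁ (s≤s w≤v) = w≤v
  ... | inj₂ w≡1+v     = contradiction (inj₁ (sym w≡1+v)) ¬close
  lower : (v , b) ≽ q
  lower with m≤n⇒m<n∨m≡n w≤v
  ... | inj₁ w<v  = inj₁ w<v
  ... | inj₂ refl = inj₂ (refl , ¬-not (λ ov → ¬close (inj₂ (refl , ov))))

-- An overlined 1 is a possible last part in this class and cannot be lowered, so the largest part
-- is changed instead. A list with a single part is never close and takes part in the bijection.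
count-overlined-last : ∀ n → 1 ≤ n →
  count (∁? (smallestOccurs≥? 2) ∩? smallestOverlinedAlone?) n ≡
  count ((1NotAPart? ∩? smallestOverlinedAlone?) ∩? ∁? topTwoClose?) (suc n)
count-overlined-last n 1≤n = count-bijection _ _ n (suc n) sucHead sucHead-injective into onto
  where
  into : ∀ ps → IsOverpartition n ps → (∁ (SmallestOccurs≥ 2) ∩ SmallestOverlinedAlone) ps →
    IsOverpartition (suc n) (sucHead ps) ×
    ((1NotAPart ∩ SmallestOverlinedAlone) ∩ ∁ TopTwoClose) (sucHead ps)
  into (p ∷ ps) over (_ , alone) =
    let over⁺ = sucHead-overpartition p ps over
        alone⁺  = alone-head ps refl over over⁺ alone
    in over⁺ , (alone⇒1NotAPart _ over⁺ alone⁺ , alone⁺) , sucHead-¬close p ps (proj₁ over)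

  onto : ∀ qs → IsOverpartition (suc n) qs → ((1NotAPart ∩ SmallestOverlinedAlone) ∩ ∁ TopTwoClose) qs →
    ∃ λ ps → (IsOverpartition n ps × (∁ (SmallestOccurs≥ 2) ∩ SmallestOverlinedAlone) ps) ×
             qs ≡ sucHead ps
  onto ((zero  , b) ∷ ps) (_ , () ∷ _ , _) _
  onto ((suc v , b) ∷ ps) over ((_ , alone) , ¬close) =
    let over⁻ = predHead-overpartition v b ps 1≤n over ¬close
        alone⁻  = alone-head ps refl over over⁻ alone
    in (v , b) ∷ ps , (over⁻ , alone⇒¬repeated _ over⁻ alone⁻ , alone⁻) , refl

-- Adding up the classes

count-without-1 : ∀ n → 1 ≤ n →
  count 1NotAPart? (suc n) ≡ ubar (suc n) +ℕ count (∁? (smallestOccurs≥? 2)) n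
count-without-1 n 1≤n = begin
  count 1NotAPart? (suc n)
    ≡⟨ count-split 1NotAPart? O? (suc n) ⟩
  count (1NotAPart? ∩? O?) (suc n) +ℕ count (1NotAPart? ∩? ∁? O?) (suc n)
    ≡⟨ cong₂ _+ℕ_ (count-split (1NotAPart? ∩? O?) topTwoClose? (suc n)) (sym (count-plain-last n 1≤n)) ⟩
  count ((1NotAPart? ∩? O?) ∩? topTwoClose?) (suc n) +ℕ
    count ((1NotAPart? ∩? O?) ∩? ∁? topTwoClose?) (suc n) +ℕ count (∁? S? ∩? ∁? O?) n
    ≡⟨ cong (_+ℕ count (∁? S? ∩? ∁? O?) n) (cong₂ _+ℕ_
         -- `ubar` nests its three conditions to the right, whereas the successive splits nest them
         -- to the left.
         (count-cong ((1NotAPart? ∩? O?) ∩? topTwoClose?) (1NotAPart? ∩? (O? ∩? topTwoClose?))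
           (λ ((x , y) , z) → x , y , z) (λ (x , y , z) → (x , y) , z) (suc n))
         (sym (count-overlined-last n 1≤n))) ⟩
  ubar (suc n) +ℕ count (∁? S? ∩? O?) n +ℕ count (∁? S? ∩? ∁? O?) n
    ≡⟨ +-assoc (ubar (suc n)) _ _ ⟩
  ubar (suc n) +ℕ (count (∁? S? ∩? O?) n +ℕ count (∁? S? ∩? ∁? O?) n)
    ≡⟨ cong (ubar (suc n) +ℕ_) (count-split (∁? S?) O? n) ⟨
  ubar (suc n) +ℕ count (∁? (smallestOccurs≥? 2)) n
    ∎
  where
  open ≡-Reasoning
  S? = smallestOccurs≥? 2
  O? = smallestOverlinedAlone?

pbar-suc : ∀ n → 1 ≤ n →
  pbar (suc n) ≡ (ubar (suc n) +ℕ count (∁? (smallestOccurs≥? 2)) n) +ℕ pbar n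
pbar-suc n 1≤n = trans (pbar-split 1NotAPart? (suc n)) (cong₂ _+ℕ_ (count-without-1 n 1≤n) (count-with-1 n))

-- Here `a` is the number of overpartitions of `n` with repeated smallest part, `e` the number of
-- the others, and `u` the value of `ubar` at `n + 1`. Thus `a + e` stands for `pbar n` and
-- `u + e + (a + e)` for `pbar (suc n)`.
rearrange : ∀ (a e u : ℤ) → a ≡ + 2 * (a + e) - (u + e + (a + e)) + u
rearrange = ℤ-Solver.solve-∀

theorem5p1 : ∀ (n : ℕ) → n ≥ 1 →
    + abar 2 n ≡ + 2 * + pbar n - + pbar (n +ℕ 1) + + ubar (n +ℕ 1)
theorem5p1 n n≥1 rewrite +-comm n 1 | pbar-suc n n≥1 | pbar-split (smallestOccurs≥? 2) n =
  rearrange (+ abar 2 n) (+ count (∁? (smallestOccurs≥? 2)) n) (+ ubar (suc n))
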